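{- Let $k$ be a positive integer and let $b \geq 3$ be an integer. If $S \subsetneq [0,b-1]$ is a proper subset of the integers in $[0,b-1]$ such that $S$ is $k$-free mod $b$ and $0 \in S$, then the Kempner set $\mathcal{K}(S,b)$ is $k$-free.
   Context: Intervals such as $[0,b-1]$ denote sets of integers. A set of integers is called $k$-free if it contains no arithmetic progression of length $k$, i.e. no $\{c+\Delta j : 0 \le j \le k-1\}$ with $c,\Delta$ integers and $\Delta \geq 1$. A set $S \subset [0,b-1]$ is called $k$-free mod $b$ if it contains no arithmetic progression mod $b$ of length $k$; that is, there do not exist integers $c, \Delta$ with $b \nmid \Delta$ such that, for every $j \in \{0,1,\dots,k-1\}$, the residue of $c+\Delta j$ modulo $b$ (taken in $[0,b-1]$) lies in $S$. It is not required that $\gcd(\Delta,b)=1$, and the residues need not be distinct (so for example $\{1,3,5\}$ contains arithmetic progressions mod $6$ of every length). For an integer $b\ge 2$ and a proper subset $S \subsetneq [0,b-1]$, the Kempner set $\mathcal{K}(S,b)$ is the set of non-negative integers all of whose base-$b$ digits belong to $S$ (the integer $0$ has the single digit $0$). -}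

module Defs where

open import Data.Digit using (toDigits)
open import Data.Fin.Base using (toℕ)
open import Data.Fin.Subset using (Subset; _∈_)
open import Data.Integer.Base as ℤ using (ℤ; +_; _%ℕ_)
open import Data.Integer.Divisibility using (_∣_)
open import Data.List.Relation.Unary.All using (All)
open import Data.Nat.Base using (ℕ; _<_; NonZero; NonTrivial; nonTrivial⇒n>1)
open import Data.Product.Base using (∃-syntax; _×_; proj₁)
open import Level using (0ℓ)
open import Relation.Binary.PropositionalEquality.Core using (_≡_)
open import Relation.Nullary using (¬_)
open import Relation.Nullary.Decidable using (fromWitness)
open import Relation.Unary using (Pred)

infix 4 _∈ℕ_

-- A subset of [0, b - 1] is a Subset b; this is membership of a plain
-- natural number in it.
_∈ℕ_ : ∀ {b} → ℕ → Subset b → Set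
n ∈ℕ S = ∃[ i ] (toℕ i ≡ n × i ∈ S)

Free : ℕ → Pred ℤ 0ℓ → Set
Free k A =
  ¬ (∃[ c ] ∃[ Δ ] (+ 1 ℤ.≤ Δ × (∀ j → j < k → A (c ℤ.+ Δ ℤ.* + j))))

-- z %ℕ b is the residue of z in [0, b - 1], also for negative z.
FreeMod : ℕ → (b : ℕ) .{{_ : NonZero b}} → Subset b → Set
FreeMod k b S =
  ¬ (∃[ c ] ∃[ Δ ] (¬ (+ b ∣ Δ) ×
                    (∀ j → j < k → (c ℤ.+ Δ ℤ.* + j) %ℕ b ∈ℕ S)))

-- toDigits produces the usual expansion: it has no leading zeros (the
-- most significant digit is the last entry), except that 0 is expanded
-- as the single digit 0.
Kempner : (b : ℕ) .{{_ : NonTrivial b}} → Subset b → Pred ℤ 0ℓ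
Kempner b S z =
  ∃[ n ] (z ≡ + n ×
          All (_∈ S) (proj₁ (toDigits b {fromWitness (nonTrivial⇒n>1 b)} n)))

{-# OPTIONS --safe #-}
module Submission where

-- Suppose c + Δ j lies in the Kempner set for every j < k, with Δ ≥ 1.
-- If b does not divide Δ, then the lowest digits of these terms, which are
-- their residues mod b, form a progression mod b inside S, which is
-- impossible.  If b divides Δ, write Δ = Δ' b.  All terms then share their
-- lowest digit, and deleting it leaves the terms ⌊c / b⌋ + Δ' j, a progression
-- of the same length whose common difference satisfies 1 ≤ Δ' < Δ.  Its terms
-- are again in the Kempner set: for a one-digit term the quotient is 0, which
-- is where 0 ∈ S is needed.  Strong induction on Δ finishes the proof
-- (no-progression).
--
-- The induction runs over the numbers having any expansion with digits in S,
-- possibly empty or with leading zeros (Representable).  For these, deleting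
-- the lowest digit needs no case distinction (representable-/), the role of
-- 0 ∈ S is only to give the residue of the empty expansion (representable-%),
-- and the particular list of digits computed by toDigits is irrelevant.

open import Defs
open import Data.Digit using (fromDigits; toDigits)
open import Data.Fin.Base using (toℕ)
open import Data.Fin.Properties using (toℕ<n)
open import Data.Fin.Subset using (Subset; _⊂_; ⊤; _∈_)
open import Data.Integer.Base as ℤ using (+_; -[1+_]; +≤+)
import Data.Integer.Properties as ℤ
open import Data.List.Base using ([]; _∷_)
open import Data.List.Relation.Unary.All using (All; []; _∷_)
open import Data.Nat.Base
  using (ℕ; zero; suc; _+_; _*_; _/_; _%_; _≤_; _<_; z<s; NonZero;
         NonTrivial; nonTrivial⇒nonZero; nonTrivial⇒n>1)
open import Data.Nat.Divisibility using (_∣?_; divides-refl; n∣m*n; ∣m⇒∣m*n)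
open import Data.Nat.DivMod
  using ([m+kn]%n≡m%n; m<n⇒m%n≡m; m<n⇒m/n≡0; m*n%n≡0; m*n/n≡m; 0/n≡0;
         +-distrib-/-∣ʳ; /-congˡ)
open import Data.Nat.Induction using (<-wellFounded)
open import Data.Nat.Properties using (m<m*n; *-assoc; *-comm)
open import Data.Product.Base using (∃-syntax; _×_; _,_; proj₂)
open import Induction.WellFounded using (Acc; acc)
open import Relation.Binary.PropositionalEquality
  using (_≡_; refl; sym; trans; cong; subst; module ≡-Reasoning)
open import Relation.Nullary using (¬_; yes; no)
open import Relation.Nullary.Negation using (contradiction)

-- n has some base-b expansion with all digits in S.  Leading zeros are
-- allowed, and 0 also has the empty expansion.
Representable : ∀ {b} → Subset b → ℕ → Set
Representable {b} S n =
  ∃[ ds ] (fromDigits {b} ds ≡ n × All (_∈ S) ds)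

module _ {b : ℕ} .{{_ : NonZero b}} {S : Subset b} where

  -- The empty expansion has no lowest digit, so 0 ∈ S supplies it.
  representable-% : 0 ∈ℕ S → ∀ {n} → Representable S n → (n % b) ∈ℕ S
  representable-% 0∈S ([] , refl , []) =
    subst (_∈ℕ S) (sym (m*n%n≡0 0 b)) 0∈S
  representable-% 0∈S (d ∷ ds , refl , d∈S ∷ _) = d , sym n%b≡d , d∈S
    where
    n%b≡d : (toℕ d + fromDigits ds * b) % b ≡ toℕ d
    n%b≡d = trans ([m+kn]%n≡m%n (toℕ d) (fromDigits ds) b)
                  (m<n⇒m%n≡m (toℕ<n d))

  representable-/ : ∀ {n} → Representable S n → Representable S (n / b)
  representable-/ ([] , refl , []) = [] , sym (0/n≡0 b) , []
  representable-/ (d ∷ ds , refl , _ ∷ ds∈S) = ds , sym n/b≡ds , ds∈S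
    where
    open ≡-Reasoning
    n/b≡ds : (toℕ d + fromDigits ds * b) / b ≡ fromDigits ds
    n/b≡ds = begin
      (toℕ d + fromDigits ds * b) / b
        ≡⟨ +-distrib-/-∣ʳ (toℕ d) (n∣m*n (fromDigits ds)) ⟩
      toℕ d / b + fromDigits ds * b / b
        ≡⟨ cong (_+ (fromDigits ds * b / b)) (m<n⇒m/n≡0 (toℕ<n d)) ⟩
      fromDigits ds * b / b
        ≡⟨ m*n/n≡m (fromDigits ds) b ⟩
      fromDigits ds ∎

[c+mb*j]/b≡c/b+m*j : ∀ c m b j .{{_ : NonZero b}} →
                     (c + m * b * j) / b ≡ c / b + m * j
[c+mb*j]/b≡c/b+m*j c m b j = begin
  (c + m * b * j) / b      ≡⟨ +-distrib-/-∣ʳ c (∣m⇒∣m*n j (n∣m*n m)) ⟩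
  c / b + m * b * j / b    ≡⟨ cong (_+_ (c / b)) (/-congˡ mbj≡mjb) ⟩
  c / b + m * j * b / b    ≡⟨ cong (_+_ (c / b)) (m*n/n≡m (m * j) b) ⟩
  c / b + m * j            ∎
  where
  open ≡-Reasoning
  mbj≡mjb : m * b * j ≡ m * j * b
  mbj≡mjb = begin
    m * b * j    ≡⟨ *-assoc m b j ⟩
    m * (b * j)  ≡⟨ cong (m *_) (*-comm b j) ⟩
    m * (j * b)  ≡⟨ *-assoc m j b ⟨
    m * j * b    ∎

pos-+-* : ∀ c Δ j → + (c + Δ * j) ≡ + c ℤ.+ + Δ ℤ.* + j
pos-+-* c Δ j = trans (ℤ.pos-+ c (Δ * j)) (cong (ℤ._+_ (+ c)) (ℤ.pos-* Δ j))

-- The theorem for progressions of natural numbers, by induction on the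
-- common difference.
no-progression :
  ∀ {k b} .{{_ : NonZero b}} {S : Subset b} → 1 < b → FreeMod k b S → 0 ∈ℕ S →
  ∀ c Δ → Acc _<_ Δ → 0 < Δ → ¬ (∀ j → j < k → Representable S (c + Δ * j))
no-progression {k} {b} {S} 1<b free 0∈S c Δ (acc rec) 0<Δ prog with b ∣? Δ
... | no b∤Δ = free (+ c , + Δ , b∤Δ , residues)
  where
  residues : ∀ j → j < k → ((+ c ℤ.+ + Δ ℤ.* + j) ℤ.%ℕ b) ∈ℕ S
  residues j j<k = subst (λ z → (z ℤ.%ℕ b) ∈ℕ S) (pos-+-* c Δ j)
                         (representable-% 0∈S (prog j j<k))
... | yes (divides-refl zero) = contradiction 0<Δ λ ()
... | yes (divides-refl m@(suc _)) =
  no-progression 1<b free 0∈S (c / b) m (rec (m<m*n m b 1<b)) z<s quotients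
  where
  quotients : ∀ j → j < k → Representable S (c / b + m * j)
  quotients j j<k = subst (Representable S) ([c+mb*j]/b≡c/b+m*j c m b j)
                          (representable-/ (prog j j<k))

Kempner⇒Representable : ∀ {b} .{{_ : NonTrivial b}} {S : Subset b} {n} →
                        Kempner b S (+ n) → Representable S n
Kempner⇒Representable {b} (n , refl , ds∈S) =
  _ , proj₂ (toDigits b n) , ds∈S

theorem1p2 : (k b : ℕ) .{{_ : NonTrivial b}} → 1 ≤ k → 3 ≤ b →
    (S : Subset b) → S ⊂ ⊤ →
    FreeMod k b {{nonTrivial⇒nonZero b}} S → 0 ∈ℕ S →
    Free k (Kempner b S)
theorem1p2 k b 1≤k _ S _ free 0∈S (+ c , + Δ , +≤+ 0<Δ , prog) =
  no-progression {{nonTrivial⇒nonZero b}} (nonTrivial⇒n>1 b) free 0∈S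
    c Δ (<-wellFounded Δ) 0<Δ
    λ j j<k → Kempner⇒Representable
                (subst (Kempner b S) (sym (pos-+-* c Δ j)) (prog j j<k))
-- A negative first term is excluded because the term at j = 0, which exists
-- by 1 ≤ k, is a natural number.
theorem1p2 k b 1≤k _ S _ free 0∈S (-[1+ c ] , Δ , _ , prog)
  with prog 0 1≤k
... | n , eq , _ = contradiction (trans (sym first) eq) λ ()
  where
  first : -[1+ c ] ℤ.+ Δ ℤ.* + 0 ≡ -[1+ c ]
  first = trans (cong (ℤ._+_ -[1+ c ]) (ℤ.*-zeroʳ Δ)) (ℤ.+-identityʳ -[1+ c ])
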